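{- Let $G$ be an $n$-vertex graph of treewidth $t$ and let $\mathcal{H},\mathcal{K}$ be non-piercing families of subgraphs of $G$. Then $|\mathcal{H}|,|\mathcal{K}|=O(n^{3t+3})$.
   Context: Subgraphs are identified with their vertex sets (induced subgraphs), so the members of $\mathcal{H}$ (and of $\mathcal{K}$) are distinct vertex subsets. A family of connected subgraphs of $G$ is non-piercing if for any two members $H,H'$ the subgraph of $G$ induced on $V(H)\setminus V(H')$ is connected. -}

module Defs where

open import Data.Nat using (ℕ; zero; suc; _+_; _*_; _^_; _≤_)
open import Data.Fin using (Fin; zero; suc; inject₁; fromℕ)
open import Data.Fin.Subset using (Subset; _∈_; _─_; ∣_∣)
open import Data.List using (List; length)
open import Data.List.Relation.Unary.All using (All)
open import Data.List.Relation.Unary.Unique.Propositional using (Unique)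
open import Data.List.Membership.Propositional using () renaming (_∈_ to _∈ₗ_)
open import Data.Product using (Σ; _×_; ∃)
open import Relation.Nullary using (¬_)
open import Function.Definitions using (Injective)
open import Relation.Binary.PropositionalEquality using (_≡_)

record Graph (n : ℕ) : Set₁ where
  field
    Adj    : Fin n → Fin n → Set
    sym    : ∀ {u v} → Adj u v → Adj v u
    irrefl : ∀ {u} → ¬ Adj u u
open Graph public

data Walk {n} (G : Graph n) (P : Fin n → Set) : Fin n → Fin n → Set where
  here : ∀ {u} → P u → Walk G P u u
  step : ∀ {u w v} → P u → Adj G u w → Walk G P w v → Walk G P u v

-- The subgraph of G induced on {v | P v} is connected (the empty one counts as connected).
ConnectedOn : ∀ {n} → Graph n → (Fin n → Set) → Set
ConnectedOn G P = ∀ u v → P u → P v → Walk G P u v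

Connected : ∀ {n} → Graph n → Set
Connected G = ConnectedOn G (λ _ → Data.Unit.⊤)
  where import Data.Unit

HasCycle : ∀ {m} → Graph m → Set
HasCycle {m} T =
  Σ ℕ λ k → 2 ≤ k × Σ (Fin (suc k) → Fin m) λ f →
    Injective _≡_ _≡_ f ×
    (∀ (i : Fin k) → Adj T (f (inject₁ i)) (f (suc i))) ×
    Adj T (f (fromℕ k)) (f zero)

IsTree : ∀ {m} → Graph m → Set
IsTree T = Connected T × ¬ HasCycle T

record TreeDecomposition {n} (G : Graph n) : Set₁ where
  field
    m       : ℕ
    T       : Graph (suc m)
    isTree  : IsTree T
    bag     : Fin (suc m) → Subset n
    cover   : ∀ v → ∃ λ x → v ∈ bag x
    edges   : ∀ u v → Adj G u v → ∃ λ x → (u ∈ bag x × v ∈ bag x)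
    coherent : ∀ v → ConnectedOn T (λ x → v ∈ bag x)
open TreeDecomposition public

WidthAtMost : ∀ {n} {G : Graph n} → TreeDecomposition G → ℕ → Set
WidthAtMost D t = ∀ x → ∣ bag D x ∣ ≤ suc t

Treewidth : ∀ {n} → Graph n → ℕ → Set₁
Treewidth G t =
  (Σ (TreeDecomposition G) λ D → WidthAtMost D t) ×
  (∀ (D : TreeDecomposition G) → ∃ λ x → suc t ≤ ∣ bag D x ∣)

-- A family (list of distinct vertex sets) of connected induced subgraphs which is non-piercing.
NonPiercingFamily : ∀ {n} → Graph n → List (Subset n) → Set
NonPiercingFamily G ℋ =
  Unique ℋ ×
  All (λ H → ConnectedOn G (_∈ H)) ℋ ×
  (∀ H H' → H ∈ₗ ℋ → H' ∈ₗ ℋ → ConnectedOn G (_∈ (H ─ H')))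

{-# OPTIONS --safe #-}
module Submission where

-- A non-piercing family ℋ shatters no set S of size 3t + 4, so Sauer–Shelah bounds |ℋ| by (n + 1) ^ (3t + 3).
-- Suppose S is shattered and let B be a bag.  If S ─ B contains k disjoint pairs, each separated by B, then for every
-- set F of pairs choose a member H_F that meets S exactly in the pairs of F.  For F ⊄ F′ the connected graph
-- H_F ─ H_F′ contains a separated pair, so it meets B, and it does so outside S; hence F ↦ H_F ∩ (B ─ S) is injective and
-- k ≤ |B ─ S|.  By a matching argument, some component of G − B then contains all but t + 1 elements of S.  Let every
-- node of the decomposition tree point to a neighbour in the direction of that component.  Since the tree has no
-- cycle, two adjacent nodes point to each other; the two components share an element of S because 2(t + 1) < 3t + 4,
-- which contradicts that the edge between the two nodes is a bridge.

open import Defs renaming (sym to Adj-sym)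
open import Algebra.Properties.CommutativeSemigroup using (interchange)
open import Data.Bool using (Bool; true; false; _∧_; _∨_; if_then_else_)
open import Data.Bool.Properties using () renaming (_≟_ to _≟ᵇ_)
open import Data.Empty using (⊥; ⊥-elim)
open import Data.Fin using (Fin; zero; suc; toℕ; fromℕ; inject₁; inject≤; finToFun; funToFin; combine)
open import Data.Fin.Properties using (_≟_; any?; pigeonhole; funToFin-finToFin; finToFun-funToFin; ¬∀⟶∃¬; toℕ-fromℕ; toℕ-inject₁; toℕ<n; toℕ-injective; inject≤-injective; suc-injective; ∀-cons)
open import Data.Fin.Subset using (Subset; inside; outside; _∈_; _∉_; _∩_; _─_; ∣_∣) renaming (⊥ to ∅)
open import Data.Fin.Subset.Properties using (_∈?_; ∣⊥∣≡0; ∉⊥; ∣p∣≤n; x∈p∧x∉q⇒x∈p─q; x∈p∩q⁺; p─q⊆p; ∩-comm)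
open import Data.List using (List; []; _∷_; _++_; length; lookup; map; filter)
open import Data.List.Membership.Propositional using (find) renaming (_∈_ to _∈ₗ_; _∉_ to _∉ₗ_)
open import Data.List.Membership.Propositional.Properties using (∈-∃++; ∈-lookup; ∈-filter⁺; ∈-filter⁻; ∈-map⁺; ∈-map⁻; ∈-++⁺ˡ; ∈-++⁺ʳ)
open import Data.List.Properties using (length-++; length-map; filter-none)
open import Data.List.Relation.Binary.Permutation.Propositional using (_↭_; ↭-sym; prep; ↭⇒↭ₛ)
import Data.List.Relation.Binary.Permutation.Setoid.Properties as ↭ₛ
open import Data.List.Relation.Binary.Permutation.Propositional.Properties using (shift; ↭-length; ∈-resp-↭)
open import Data.List.Relation.Binary.Subset.Propositional using (_⊆_)
import Data.List.Relation.Unary.All as All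
open import Data.List.Relation.Unary.All.Properties using (¬Any⇒All¬)
import Data.List.Relation.Unary.Any as Any
open Any using (here; there)
open import Data.List.Relation.Unary.AllPairs using ([]; _∷_)
open import Data.List.Relation.Unary.Unique.Propositional using (Unique)
open import Data.List.Relation.Unary.Unique.Propositional.Properties using () renaming (filter⁺ to filter-unique; map⁺ to map-unique)
open import Data.Nat using (ℕ; zero; suc; _+_; _*_; _^_; _≤_; _<_; z≤n; s≤s; _<?_)
open import Data.Nat.Properties hiding (_≟_; suc-injective)
open import Data.Product using (Σ; ∃; ∃₂; _×_; _,_; proj₁; proj₂)
open import Data.Sum using (_⊎_; inj₁; inj₂)
import Data.Vec as Vec
open Vec using ([]; _∷_)
open import Data.Vec.Properties using ([]=⇒lookup; lookup⇒[]=; ≡-dec)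
open import Function using (_∘_; id)
open import Function.Definitions using (Injective)
open import Data.List.Relation.Unary.Any.Properties using (lookup-index)
open import Data.Nat.GeneralisedArithmetic using (fold; fold-+)
open import Data.Nat.Induction using (<-wellFounded)
open import Induction.WellFounded using (Acc; acc)
open import Relation.Binary.Definitions using (tri<; tri≈; tri>)
open import Relation.Binary.Construct.Closure.ReflexiveTransitive using (Star; ε; _◅_; _◅◅_; gmap; reverse)
open import Relation.Binary.PropositionalEquality using (_≡_; _≢_; refl; sym; trans; cong; cong₂; subst; setoid; module ≡-Reasoning)
open import Relation.Nullary using (¬_; Dec; yes; no; does; contradiction; ¬?)
open import Relation.Nullary.Decidable using (decidable-stable; ¬¬-excluded-middle; _×-dec_; _⊎-dec_; dec-true; dec-false)

private variable
  n : ℕ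

-- Sauer–Shelah

-- With characteristic functions, splitting by the first vertex is a composition, and union and
-- intersection of the two halves are pointwise `∨` and `∧`.
Family : ℕ → Set
Family n = Subset n → Bool

Shatters : Family n → Subset n → Set
Shatters {n} χ S =
  (P : Fin n → Bool) → ∃ λ H → χ H ≡ true × (∀ v → v ∈ S → Vec.lookup H v ≡ P v)

count : Family n → ℕ
count {zero}  χ = if χ [] then 1 else 0
count {suc n} χ = count (χ ∘ (outside ∷_)) + count (χ ∘ (inside ∷_))

members : Family n → List (Subset n)
members {zero}  χ = if χ [] then [] ∷ [] else []
members {suc n} χ = map (outside ∷_) (members (χ ∘ (outside ∷_))) ++ map (inside ∷_) (members (χ ∘ (inside ∷_)))

length-members : (χ : Family n) → length (members χ) ≡ count χ
length-members {zero} χ with χ []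
... | true  = refl
... | false = refl
length-members {suc n} χ = begin
  length (map (outside ∷_) ms₀ ++ map (inside ∷_) ms₁)              ≡⟨ length-++ (map (outside ∷_) ms₀) ⟩
  length (map (outside ∷_) ms₀) + length (map (inside ∷_) ms₁)      ≡⟨ cong₂ _+_ (length-map _ ms₀) (length-map _ ms₁) ⟩
  length ms₀ + length ms₁                                           ≡⟨ cong₂ _+_ (length-members (χ ∘ (outside ∷_))) (length-members (χ ∘ (inside ∷_))) ⟩
  count χ                                                           ∎
  where
  open ≡-Reasoning
  ms₀ = members (χ ∘ (outside ∷_))
  ms₁ = members (χ ∘ (inside ∷_))

∈-members : (χ : Family n) (H : Subset n) → χ H ≡ true → H ∈ₗ members χ
∈-members χ [] χH rewrite χH = here refl
∈-members χ (outside ∷ H) χH = ∈-++⁺ˡ (∈-map⁺ _ (∈-members _ H χH))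
∈-members χ (inside ∷ H) χH = ∈-++⁺ʳ (map (outside ∷_) (members (χ ∘ (outside ∷_)))) (∈-map⁺ _ (∈-members _ H χH))

count-∨-∧ : (χ ψ : Family n) → count χ + count ψ ≡ count (λ H → χ H ∨ ψ H) + count (λ H → χ H ∧ ψ H)
count-∨-∧ {zero} χ ψ with χ [] | ψ []
... | true  | true  = refl
... | true  | false = refl
... | false | true  = refl
... | false | false = refl
count-∨-∧ {suc n} χ ψ = begin
  (χ₀ + χ₁) + (ψ₀ + ψ₁)  ≡⟨ interchange +-commutativeSemigroup χ₀ χ₁ ψ₀ ψ₁ ⟩
  (χ₀ + ψ₀) + (χ₁ + ψ₁)  ≡⟨ cong₂ _+_ (count-∨-∧ (χ ∘ (outside ∷_)) (ψ ∘ (outside ∷_))) (count-∨-∧ (χ ∘ (inside ∷_)) (ψ ∘ (inside ∷_))) ⟩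
  (u₀ + i₀) + (u₁ + i₁)  ≡⟨ interchange +-commutativeSemigroup u₀ i₀ u₁ i₁ ⟩
  (u₀ + u₁) + (i₀ + i₁)  ∎
  where
  open ≡-Reasoning
  χ₀ = count (χ ∘ (outside ∷_))
  χ₁ = count (χ ∘ (inside ∷_))
  ψ₀ = count (ψ ∘ (outside ∷_))
  ψ₁ = count (ψ ∘ (inside ∷_))
  u₀ = count (λ H → χ (outside ∷ H) ∨ ψ (outside ∷ H))
  u₁ = count (λ H → χ (inside ∷ H) ∨ ψ (inside ∷ H))
  i₀ = count (λ H → χ (outside ∷ H) ∧ ψ (outside ∷ H))
  i₁ = count (λ H → χ (inside ∷ H) ∧ ψ (inside ∷ H))

count>0⇒member : (χ : Family n) → 0 < count χ → ∃ λ H → χ H ≡ true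
count>0⇒member {zero} χ 0<c with χ [] in eq
... | true = [] , eq
count>0⇒member {suc n} χ 0<c with 0 <? count (χ ∘ (outside ∷_))
... | yes 0<c₀ = let H , χH = count>0⇒member _ 0<c₀ in outside ∷ H , χH
... | no  c₀≤0 = let H , χH = count>0⇒member _ 0<c₁ in inside ∷ H , χH
  where
  0<c₁ : 0 < count (χ ∘ (inside ∷_))
  0<c₁ = subst (λ c → 0 < c + count (χ ∘ (inside ∷_))) (n≤0⇒n≡0 (≮⇒≥ c₀≤0)) 0<c

-- The union of the halves is the projection of `χ` that forgets the first vertex, so each pattern
-- realised there lifts with one of the two values.
∨-shatters : (χ : Family (suc n)) {S : Subset n} →
  Shatters (λ H → χ (outside ∷ H) ∨ χ (inside ∷ H)) S → Shatters χ (outside ∷ S)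
∨-shatters χ sh P with sh (P ∘ suc)
... | H , χH , agree with χ (outside ∷ H) in eq
... | true  = outside ∷ H , eq , λ { (suc v) (Vec.there v∈S) → agree v v∈S }
... | false = inside ∷ H , χH , λ { (suc v) (Vec.there v∈S) → agree v v∈S }

-- A set in both halves extends in both ways, so the value at the first vertex can be prescribed
-- freely.
∧-shatters : (χ : Family (suc n)) {S : Subset n} →
  Shatters (λ H → χ (outside ∷ H) ∧ χ (inside ∷ H)) S → Shatters χ (inside ∷ S)
∧-shatters χ sh P with sh (P ∘ suc)
... | H , χH , agree = P zero ∷ H , χPH (P zero) , λ { zero _ → refl ; (suc v) (Vec.there v∈S) → agree v v∈S }
  where
  χPH : ∀ p → χ (p ∷ H) ≡ true
  χPH p with χ (outside ∷ H) in eq₀ | χ (inside ∷ H) in eq₁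
  χPH true  | true | true = eq₁
  χPH false | true | true = eq₀

-- For d > 0 this dominates the number of subsets of size < d of an n-element set.
sauerBound : ℕ → ℕ → ℕ
sauerBound zero    n = 0
sauerBound (suc d) n = suc n ^ d

sauerBound-step : ∀ d n → sauerBound (suc d) n + sauerBound d n ≤ sauerBound (suc d) (suc n)
sauerBound-step zero    n = ≤-refl
sauerBound-step (suc d) n = begin
  suc n * suc n ^ d + suc n ^ d  ≡⟨ +-comm (suc n * suc n ^ d) (suc n ^ d) ⟩
  suc (suc n) * suc n ^ d        ≤⟨ *-monoʳ-≤ (suc (suc n)) (^-monoˡ-≤ d (n≤1+n (suc n))) ⟩
  suc (suc n) ^ suc d            ∎
  where open ≤-Reasoning

-- Induction on `n`. By `count-∨-∧`, the union and the intersection of the two halves together count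
-- as much as `χ`. Either the union is large and shatters a set of the same size `d`, or the
-- intersection is large and the first vertex joins a shattered set of size one less.
sauer-shelah : ∀ d (χ : Family n) → sauerBound d n < count χ → ∃ λ S → ∣ S ∣ ≡ d × Shatters χ S
sauer-shelah {n} zero χ big =
  ∅ , ∣⊥∣≡0 n , λ P → let H , χH = count>0⇒member χ big in H , χH , λ v v∈∅ → contradiction v∈∅ ∉⊥
-- Without vertices the bound is `1 ^ d`, while there is only one subset.
sauer-shelah {zero} (suc d) χ big = contradiction (≤-trans (s≤s (m^n>0 1 d)) big) (≤⇒≯ count≤1)
  where
  count≤1 : count χ ≤ 1
  count≤1 with χ []
  ... | true  = ≤-refl
  ... | false = z≤n
sauer-shelah {suc n} (suc d) χ big with sauerBound (suc d) n <? count (λ H → χ (outside ∷ H) ∨ χ (inside ∷ H))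
... | yes big∨ = let S , ∣S∣ , sh = sauer-shelah (suc d) _ big∨ in outside ∷ S , ∣S∣ , ∨-shatters χ sh
... | no small∨ = let S , ∣S∣ , sh = sauer-shelah d _ big∧ in inside ∷ S , cong suc ∣S∣ , ∧-shatters χ sh
  where
  open ≤-Reasoning
  c∨ = count (λ H → χ (outside ∷ H) ∨ χ (inside ∷ H))
  c∧ = count (λ H → χ (outside ∷ H) ∧ χ (inside ∷ H))
  big∧ : sauerBound d n < c∧
  big∧ = +-cancelˡ-< (sauerBound (suc d) n) (sauerBound d n) c∧ (begin-strict
    sauerBound (suc d) n + sauerBound d n  ≤⟨ sauerBound-step d n ⟩
    sauerBound (suc d) (suc n)             <⟨ big ⟩
    count χ                                ≡⟨ count-∨-∧ (χ ∘ (outside ∷_)) (χ ∘ (inside ∷_)) ⟩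
    c∨ + c∧                                ≤⟨ +-monoˡ-≤ c∧ (≮⇒≥ small∨) ⟩
    sauerBound (suc d) n + c∧              ∎)

-- Lists and subsets

extract : ∀ {A : Set} {x : A} {xs} → x ∈ₗ xs → ∃ λ ys → xs ↭ x ∷ ys
extract x∈xs with ∈-∃++ x∈xs
... | ys , zs , refl = ys ++ zs , shift _ ys zs

unique-⊆⇒length-≤ : ∀ {A : Set} {xs ys : List A} → Unique xs → xs ⊆ ys → length xs ≤ length ys
unique-⊆⇒length-≤ [] _ = z≤n
unique-⊆⇒length-≤ {xs = x ∷ xs} (x∉xs ∷ unique) sub with extract (sub (here refl))
... | ys′ , perm = subst (suc (length xs) ≤_) (sym (↭-length perm)) (s≤s (unique-⊆⇒length-≤ unique sub′))
  where
  sub′ : xs ⊆ ys′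
  sub′ v∈xs with ∈-resp-↭ perm (sub (there v∈xs))
  ... | here refl = contradiction refl (All.lookup x∉xs v∈xs)
  ... | there v∈ys′ = v∈ys′

lookup-injective : ∀ {A : Set} {xs : List A} → Unique xs → ∀ i j → lookup xs i ≡ lookup xs j → i ≡ j
lookup-injective (_ ∷ _) zero    zero    _  = refl
lookup-injective (x∉ ∷ _) zero   (suc j) eq = contradiction eq (All.lookup x∉ (∈-lookup j))
lookup-injective (x∉ ∷ _) (suc i) zero   eq = contradiction (sym eq) (All.lookup x∉ (∈-lookup i))
lookup-injective (_ ∷ u) (suc i) (suc j) eq = cong suc (lookup-injective u i j eq)

length-filter-¬ : ∀ {A : Set} {P : A → Set} (P? : ∀ x → Dec (P x)) xs →
  length (filter P? xs) + length (filter (¬? ∘ P?) xs) ≡ length xs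
length-filter-¬ P? [] = refl
length-filter-¬ P? (x ∷ xs) with P? x
... | yes _ = cong suc (length-filter-¬ P? xs)
... | no  _ = trans (+-suc _ _) (cong suc (length-filter-¬ P? xs))

elements : Subset n → List (Fin n)
elements [] = []
elements (inside  ∷ S) = zero ∷ map suc (elements S)
elements (outside ∷ S) = map suc (elements S)

length-elements : (S : Subset n) → length (elements S) ≡ ∣ S ∣
length-elements [] = refl
length-elements (inside  ∷ S) = cong suc (trans (length-map suc (elements S)) (length-elements S))
length-elements (outside ∷ S) = trans (length-map suc (elements S)) (length-elements S)

∈-elements⁺ : {S : Subset n} {v : Fin n} → v ∈ S → v ∈ₗ elements S
∈-elements⁺ {S = _ ∷ _}       Vec.here        = here refl
∈-elements⁺ {S = inside ∷ _}  (Vec.there v∈S) = there (∈-map⁺ suc (∈-elements⁺ v∈S))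
∈-elements⁺ {S = outside ∷ _} (Vec.there v∈S) = ∈-map⁺ suc (∈-elements⁺ v∈S)

∈-elements⁻ : (S : Subset n) {v : Fin n} → v ∈ₗ elements S → v ∈ S
∈-elements⁻ (inside ∷ S) (here refl) = Vec.here
∈-elements⁻ (inside ∷ S) (there v∈) with ∈-map⁻ suc v∈
... | _ , w∈ , refl = Vec.there (∈-elements⁻ S w∈)
∈-elements⁻ (outside ∷ S) v∈ with ∈-map⁻ suc v∈
... | _ , w∈ , refl = Vec.there (∈-elements⁻ S w∈)

elements-unique : (S : Subset n) → Unique (elements S)
elements-unique [] = []
elements-unique (inside ∷ S) = All.tabulate zero∉ ∷ map-unique suc-injective (elements-unique S)
  where
  zero∉ : ∀ {v} → v ∈ₗ map suc (elements S) → zero ≢ v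
  zero∉ v∈ refl with ∈-map⁻ suc v∈
  ... | _ , _ , ()
elements-unique (outside ∷ S) = map-unique suc-injective (elements-unique S)

∣p∩q∣+∣p─q∣≡∣p∣ : (p q : Subset n) → ∣ p ∩ q ∣ + ∣ p ─ q ∣ ≡ ∣ p ∣
∣p∩q∣+∣p─q∣≡∣p∣ [] [] = refl
∣p∩q∣+∣p─q∣≡∣p∣ (inside  ∷ p) (inside  ∷ q) = cong suc (∣p∩q∣+∣p─q∣≡∣p∣ p q)
∣p∩q∣+∣p─q∣≡∣p∣ (inside  ∷ p) (outside ∷ q) = trans (+-suc _ _) (cong suc (∣p∩q∣+∣p─q∣≡∣p∣ p q))
∣p∩q∣+∣p─q∣≡∣p∣ (outside ∷ p) (inside  ∷ q) = ∣p∩q∣+∣p─q∣≡∣p∣ p q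
∣p∩q∣+∣p─q∣≡∣p∣ (outside ∷ p) (outside ∷ q) = ∣p∩q∣+∣p─q∣≡∣p∣ p q

x∈p─q⇒x∉q : (p q : Subset n) {v : Fin n} → v ∈ p ─ q → v ∉ q
x∈p─q⇒x∉q (inside ∷ p) (outside ∷ q) Vec.here ()
x∈p─q⇒x∉q (_ ∷ p) (inside  ∷ q) (Vec.there v∈) (Vec.there v∈q) = x∈p─q⇒x∉q p q v∈ v∈q
x∈p─q⇒x∉q (_ ∷ p) (outside ∷ q) (Vec.there v∈) (Vec.there v∈q) = x∈p─q⇒x∉q p q v∈ v∈q

-- Matchings of unrelated elements

-- Ends of distinct pairs differ by `disjoint`; the two ends of one pair differ by `apart` whenever
-- `R` is reflexive.
record Matching {A : Set} (R : A → A → Set) (L : List A) (k : ℕ) : Set where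
  field
    end      : Fin k → Bool → A
    end∈     : ∀ i x → end i x ∈ₗ L
    apart    : ∀ i → ¬ R (end i true) (end i false)
    disjoint : ∀ {i j} x y → end i x ≡ end j y → i ≡ j

module ClassMatching {A : Set} {R : A → A → Set} (R? : ∀ u v → Dec (R u v))
  (R-refl : ∀ {u} → R u u) (R-trans : ∀ {u v w} → R u v → R v w → R u w) where

  related unrelated : A → List A → List A
  related   w = filter (R? w)
  unrelated w = filter (¬? ∘ R? w)

  -- If `R w u` but not `R w v`, transitivity rules out `R u v`; hence any injective pairing of the
  -- class of `w` with its complement works.
  cross-matching : ∀ {k L} w → Unique L →
    k ≤ length (related w L) → k ≤ length (unrelated w L) → Matching R L k
  cross-matching {k} {L} w unique k≤W k≤U = record
    { end = end ; end∈ = end∈ ; apart = λ i → apart (W∈ i) (U∈ i) ; disjoint = disjoint }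
    where
    end : Fin k → Bool → A
    end i true  = lookup (related w L) (inject≤ i k≤W)
    end i false = lookup (unrelated w L) (inject≤ i k≤U)
    W∈ : ∀ i → end i true ∈ₗ L × R w (end i true)
    W∈ i = ∈-filter⁻ (R? w) (∈-lookup (inject≤ i k≤W))
    U∈ : ∀ i → end i false ∈ₗ L × ¬ R w (end i false)
    U∈ i = ∈-filter⁻ (¬? ∘ R? w) (∈-lookup (inject≤ i k≤U))
    end∈ : ∀ i x → end i x ∈ₗ L
    end∈ i true  = proj₁ (W∈ i)
    end∈ i false = proj₁ (U∈ i)
    apart : ∀ {u v} → u ∈ₗ L × R w u → v ∈ₗ L × ¬ R w v → ¬ R u v
    apart (_ , wRu) (_ , ¬wRv) uRv = ¬wRv (R-trans wRu uRv)
    disjoint : ∀ {i j} x y → end i x ≡ end j y → i ≡ j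
    disjoint true  true  eq = inject≤-injective k≤W k≤W _ _ (lookup-injective (filter-unique (R? w) unique) _ _ eq)
    disjoint false false eq = inject≤-injective k≤U k≤U _ _ (lookup-injective (filter-unique (¬? ∘ R? w) unique) _ _ eq)
    disjoint {i} {j} true false eq = contradiction (subst (R w) eq (proj₂ (W∈ i))) (proj₂ (U∈ j))
    disjoint {i} {j} false true eq = contradiction (subst (R w) (sym eq) (proj₂ (W∈ j))) (proj₂ (U∈ i))

  extend : ∀ {k L L′ a b} → ¬ R a b → L ↭ a ∷ b ∷ L′ → a ∉ₗ L′ → b ∉ₗ L′ →
    Matching R L′ k → Matching R L (suc k)
  extend {k} {L} {L′} {a} {b} ¬aRb perm a∉ b∉ M = record
    { end = end ; end∈ = end∈ ; apart = apart ; disjoint = disjoint }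
    where
    module M = Matching M
    end : Fin (suc k) → Bool → A
    end zero    true  = a
    end zero    false = b
    end (suc i) x     = M.end i x
    end∈ : ∀ i x → end i x ∈ₗ L
    end∈ zero    true  = ∈-resp-↭ (↭-sym perm) (here refl)
    end∈ zero    false = ∈-resp-↭ (↭-sym perm) (there (here refl))
    end∈ (suc i) x     = ∈-resp-↭ (↭-sym perm) (there (there (M.end∈ i x)))
    apart : ∀ i → ¬ R (end i true) (end i false)
    apart zero    = ¬aRb
    apart (suc i) = M.apart i
    fresh : ∀ x {j y} → end zero x ≢ M.end j y
    fresh true  eq = a∉ (subst (_∈ₗ L′) (sym eq) (M.end∈ _ _))
    fresh false eq = b∉ (subst (_∈ₗ L′) (sym eq) (M.end∈ _ _))
    disjoint : ∀ {i j} x y → end i x ≡ end j y → i ≡ j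
    disjoint {zero}  {zero}  x y _  = refl
    disjoint {zero}  {suc j} x y eq = contradiction eq (fresh x)
    disjoint {suc i} {zero}  x y eq = contradiction (sym eq) (fresh y)
    disjoint {suc i} {suc j} x y eq = cong suc (M.disjoint x y eq)

  -- Induction on `k`: set aside an unrelated pair and recurse on the rest. A matching there is
  -- extended by this pair. A dominant class there either stays dominant or, having more than `k`
  -- elements both inside and outside it, supplies `suc k` pairs by `cross-matching`.
  matching-or-dominant-class : ∀ k L → Unique L → 2 * k ≤ length L →
    Matching R L k ⊎ ∃ λ w → w ∈ₗ L × length (unrelated w L) < k
  matching-or-dominant-class zero L _ _ =
    inj₁ record { end = λ () ; end∈ = λ () ; apart = λ () ; disjoint = λ { {()} } }
  matching-or-dominant-class (suc k) (a ∷ L) (a∉L ∷ unique) 2k≤ with Any.any? (¬? ∘ R? a) L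
  ... | no all-related = inj₂ (a , here refl , s≤s (subst (λ U → length U ≤ k) (sym none) z≤n))
    where
    none : unrelated a (a ∷ L) ≡ []
    none = filter-none (¬? ∘ R? a) ((λ ¬aRa → ¬aRa R-refl) All.∷ ¬Any⇒All¬ L all-related)
  ... | yes some-apart with find some-apart
  ... | b , b∈L , ¬aRb with extract b∈L
  ... | L′ , perm with ↭ₛ.Unique-resp-↭ (setoid A) (↭⇒↭ₛ perm) unique
  ... | b∉L′ ∷ unique′ = recurse (matching-or-dominant-class k L′ unique′ 2k≤∣L′∣)
    where
    perm⁺ : a ∷ L ↭ a ∷ b ∷ L′
    perm⁺ = prep a perm
    L′⊆ : L′ ⊆ a ∷ L
    L′⊆ v∈ = ∈-resp-↭ (↭-sym perm⁺) (there (there v∈))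
    2k≤∣L′∣ : 2 * k ≤ length L′
    2k≤∣L′∣ = ≤-pred (≤-pred (subst (2 + 2 * k ≤_) (↭-length perm⁺) (subst (_≤ length (a ∷ L)) (*-suc 2 k) 2k≤)))
    a∉L′ : a ∉ₗ L′
    a∉L′ a∈ = All.lookup a∉L (∈-resp-↭ (↭-sym perm) (there a∈)) refl
    recurse : Matching R L′ k ⊎ (∃ λ w → w ∈ₗ L′ × length (unrelated w L′) < k) →
      Matching R (a ∷ L) (suc k) ⊎ ∃ λ w → w ∈ₗ a ∷ L × length (unrelated w (a ∷ L)) < suc k
    recurse (inj₁ M) = inj₁ (extend ¬aRb perm⁺ a∉L′ (λ b∈ → All.lookup b∉L′ b∈ refl) M)
    recurse (inj₂ (w , w∈ , U′<k)) with length (unrelated w (a ∷ L)) <? suc k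
    ... | yes U<k = inj₂ (w , L′⊆ w∈ , U<k)
    ... | no  U≮k = inj₁ (cross-matching w (a∉L ∷ unique) k<W (≮⇒≥ U≮k))
      where
      k<W′ : k < length (related w L′)
      k<W′ = +-cancelʳ-< (length (unrelated w L′)) k _ (begin-strict
        k + length (unrelated w L′)                            <⟨ +-monoʳ-< k U′<k ⟩
        k + k                                                  ≡⟨ cong (k +_) (+-identityʳ k) ⟨
        2 * k                                                  ≤⟨ 2k≤∣L′∣ ⟩
        length L′                                              ≡⟨ length-filter-¬ (R? w) L′ ⟨
        length (related w L′) + length (unrelated w L′)        ∎)
        where open ≤-Reasoning
      k<W : k < length (related w (a ∷ L))
      k<W = ≤-trans k<W′ (unique-⊆⇒length-≤ (filter-unique (R? w) unique′) λ v∈ →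
        let v∈L′ , wRv = ∈-filter⁻ (R? w) v∈ in ∈-filter⁺ (R? w) (L′⊆ v∈L′) wRv)

-- Acyclic graphs

-- The format follows `HasCycle`, so that a path of length at least two and an edge joining its ends
-- form a cycle without conversion.
Path : (G : Graph n) → Fin n → Fin n → Set
Path {n} G a b = Σ ℕ λ k → Σ (Fin (suc k) → Fin n) λ f →
  Injective _≡_ _≡_ f × (∀ i → Adj G (f (inject₁ i)) (f (suc i))) × f zero ≡ a × f (fromℕ k) ≡ b

suffix : (G : Graph n) → ∀ k (f : Fin (suc k) → Fin n) →
  Injective _≡_ _≡_ f → (∀ i → Adj G (f (inject₁ i)) (f (suc i))) → ∀ j → Path G (f j) (f (fromℕ k))
suffix G k       f inj adj zero    = k , f , inj , adj , refl , refl
suffix G (suc k) f inj adj (suc j) = suffix G k (f ∘ suc) (suc-injective ∘ inj) (adj ∘ suc) j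

-- If the new first vertex already lies on the erased tail, the suffix from that occurrence is the
-- path; otherwise the vertex is prepended.
loop-erase : (G : Graph n) {a b : Fin n} → Star (Adj G) a b → Path G a b
loop-erase G {a} ε = 0 , (λ _ → a) , (λ { {zero} {zero} _ → refl }) , (λ ()) , refl , refl
loop-erase G {a} {b} (_◅_ {j = c} ac walk) with loop-erase G walk
... | k , f , inj , adj , refl , refl with any? (λ j → f j ≟ a)
... | yes (j , refl) = suffix G k f inj adj j
... | no  fresh = suc k , f⁺ , inj⁺ , adj⁺ , refl , refl
  where
  f⁺ : Fin (suc (suc k)) → Fin _
  f⁺ zero    = a
  f⁺ (suc i) = f i
  inj⁺ : Injective _≡_ _≡_ f⁺
  inj⁺ {zero}  {zero}  _  = refl
  inj⁺ {zero}  {suc j} eq = contradiction (j , sym eq) fresh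
  inj⁺ {suc i} {zero}  eq = contradiction (i , eq) fresh
  inj⁺ {suc i} {suc j} eq = cong suc (inj eq)
  adj⁺ : ∀ i → Adj G (f⁺ (inject₁ i)) (f⁺ (suc i))
  adj⁺ zero    = ac
  adj⁺ (suc i) = adj i

deleteEdge : Graph n → Fin n → Fin n → Graph n
deleteEdge G x y = record
  { Adj    = λ a b → Adj G a b × ¬ (a ≡ x × b ≡ y) × ¬ (a ≡ y × b ≡ x)
  ; sym    = λ { (ab , ¬xy , ¬yx) → Adj-sym G ab , (λ { (p , q) → ¬yx (q , p) }) , (λ { (p , q) → ¬xy (q , p) }) }
  ; irrefl = irrefl G ∘ proj₁
  }

-- A simple path from `y` to `x` of length zero would make `x` its own neighbour, one of length one
-- would be the deleted edge, and any longer one closes to a cycle through that edge.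
edges-are-bridges : (G : Graph n) → ¬ HasCycle G → ∀ {x y} → Adj G x y → ¬ Star (Adj (deleteEdge G x y)) y x
edges-are-bridges G acyclic {x} {y} xy walk with loop-erase (deleteEdge G x y) walk
... | zero , f , _ , _ , refl , refl = irrefl G xy
... | suc zero , f , _ , adj , refl , refl = proj₂ (proj₂ (adj zero)) (refl , refl)
... | suc (suc k) , f , inj , adj , refl , refl = acyclic (suc (suc k) , s≤s (s≤s z≤n) , f , inj , proj₁ ∘ adj , xy)

-- The period `suc o` equals `j − i`; the bound `o < j` makes the induction in `orbit-2-cycle`
-- decrease.
fold-repeat : ∀ {A : Set} (f : A → A) x {i j} → i < j → fold x f i ≡ fold x f j →
  ∃ λ o → o < j × fold (fold x f i) f (suc o) ≡ fold x f i
fold-repeat f x {i} {j} i<j eq with m≤n⇒∃[o]m+o≡n i<j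
... | o , refl = o , s≤s (m≤n+m o i) , (begin
  fold (fold x f i) f (suc o)  ≡⟨ fold-+ x f (suc o) {i} ⟨
  fold x f (suc o + i)         ≡⟨ cong (fold x f ∘ suc) (+-comm o i) ⟩
  fold x f (suc i + o)         ≡⟨ eq ⟨
  fold x f i                   ∎)
  where open ≡-Reasoning

module _ (G : Graph n) (acyclic : ¬ HasCycle G) (f : Fin n → Fin n) (adj : ∀ x → Adj G x (f x)) where

  -- Induction on the period `suc p`. Period one would be a loop. An orbit of period at least three
  -- either repeats earlier, which gives a smaller period, or is injective and forms a cycle.
  orbit-2-cycle : ∀ p → Acc _<_ p → ∀ x → fold x f (suc p) ≡ x → ∃ λ z → f (f z) ≡ z
  orbit-2-cycle zero _ x fx≡x = contradiction (subst (Adj G x) fx≡x (adj x)) (irrefl G)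
  orbit-2-cycle (suc zero) _ x ffx≡x = x , ffx≡x
  orbit-2-cycle (suc (suc q)) (acc rec) x eq
    with any? (λ (i : Fin (3 + q)) → any? (λ (j : Fin (3 + q)) →
           (toℕ i <? toℕ j) ×-dec (fold x f (toℕ i) ≟ fold x f (toℕ j))))
  ... | yes (i , j , i<j , same) =
    let o , o<j , eq′ = fold-repeat f x i<j same
    in orbit-2-cycle o (rec (≤-trans o<j (≤-pred (toℕ<n j)))) (fold x f (toℕ i)) eq′
  ... | no no-repeat = ⊥-elim (acyclic (2 + q , s≤s (s≤s z≤n) , orbit , inj , adj′ , closing))
    where
    orbit : Fin (3 + q) → Fin n
    orbit = fold x f ∘ toℕ
    inj : Injective _≡_ _≡_ orbit
    inj {i} {j} same with <-cmp (toℕ i) (toℕ j)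
    ... | tri< i<j _ _ = contradiction (i , j , i<j , same) no-repeat
    ... | tri≈ _ i≡j _ = toℕ-injective i≡j
    ... | tri> _ _ j<i = contradiction (j , i , j<i , sym same) no-repeat
    adj′ : ∀ i → Adj G (orbit (inject₁ i)) (orbit (suc i))
    adj′ i rewrite toℕ-inject₁ i = adj (fold x f (toℕ i))
    closing : Adj G (orbit (fromℕ (2 + q))) (orbit zero)
    closing rewrite toℕ-fromℕ q = subst (Adj G _) eq (adj (fold x f (2 + q)))

  2-cycle : Fin n → ∃ λ z → f (f z) ≡ z
  2-cycle x with pigeonhole ≤-refl (λ (i : Fin (suc n)) → fold x f (toℕ i))
  ... | i , j , i<j , same =
    let o , _ , eq = fold-repeat f x i<j same in orbit-2-cycle o (<-wellFounded o) (fold x f (toℕ i)) eq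

-- Reachability avoiding a set

-- The empty walk imposes no condition on its vertex, so the relation is reflexive on all vertices,
-- as `ClassMatching` requires.
Reach : Graph n → (Fin n → Set) → Fin n → Fin n → Set
Reach G P = Star (λ u v → Adj G u v × P u × P v)

walk⇒reach : {G : Graph n} {P : Fin n → Set} {u v : Fin n} → Walk G P u v → Reach G P u v
walk⇒reach (here _) = ε
walk⇒reach {P = P} (step Pu uw walk) = (uw , Pu , start walk) ◅ walk⇒reach walk
  where
  start : ∀ {a b} → Walk _ P a b → P a
  start (here Pa)     = Pa
  start (step Pa _ _) = Pa

reach-map : (G : Graph n) {P Q : Fin n → Set} {u v : Fin n} → (∀ {a} → P a → Q a) → Reach G P u v → Reach G Q u v
reach-map G P⇒Q = gmap id λ { (ab , Pa , Pb) → ab , P⇒Q Pa , P⇒Q Pb }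

reach-sym : (G : Graph n) {P : Fin n → Set} {u v : Fin n} → Reach G P u v → Reach G P v u
reach-sym G = reverse λ { (ab , Pa , Pb) → Adj-sym G ab , Pb , Pa }

reach-meets-or-avoids : (G : Graph n) {P : Fin n → Set} {u v : Fin n} (B : Subset n) → Reach G P u v →
  (∃ λ w → P w × w ∈ B) ⊎ Reach G (_∉ B) u v
reach-meets-or-avoids G B ε = inj₂ ε
reach-meets-or-avoids G B (_◅_ {i = u} {j = w} (uw , Pu , Pw) r) with u ∈? B | w ∈? B | reach-meets-or-avoids G B r
... | yes u∈B | _       | _      = inj₁ (u , Pu , u∈B)
... | no _    | yes w∈B | _      = inj₁ (w , Pw , w∈B)
... | no _    | no _    | inj₁ m = inj₁ m
... | no u∉B  | no w∉B  | inj₂ a = inj₂ ((uw , u∉B , w∉B) ◅ a)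

-- The walk is cut after its last visit to `x`.
first-step-avoiding : (G : Graph n) {x z : Fin n} → x ≢ z → Star (Adj G) x z →
  ∃ λ y → Adj G x y × Reach G (_≢ x) y z
first-step-avoiding G {x} {z} x≢z walk with last-visit walk
  where
  last-visit : ∀ {a} → Star (Adj G) a z → Reach G (_≢ x) a z × a ≢ x ⊎ ∃ λ y → Adj G x y × Reach G (_≢ x) y z
  last-visit ε = inj₁ (ε , x≢z ∘ sym)
  last-visit (_◅_ {i = a} {j = c} ac walk) with last-visit walk | a ≟ x
  ... | inj₂ found     | _        = inj₂ found
  ... | inj₁ (r , _)   | yes refl = inj₂ (c , ac , r)
  ... | inj₁ (r , c≢x) | no a≢x   = inj₁ ((ac , a≢x , c≢x) ◅ r , a≢x)
... | inj₁ (_ , x≢x) = contradiction refl x≢x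
... | inj₂ found     = found

funToFin-cong : ∀ {k m} {f g : Fin k → Fin m} → (∀ i → f i ≡ g i) → funToFin f ≡ funToFin g
funToFin-cong {zero}  f≗g = refl
funToFin-cong {suc k} f≗g = cong₂ combine (f≗g zero) (funToFin-cong (f≗g ∘ suc))

-- Non-piercing families shattering a set

module Shattering (G : Graph n) (χ : Family n) (S : Subset n) (shatters : Shatters χ S)
  (non-piercing : ∀ H H′ → χ H ≡ true → χ H′ ≡ true → ConnectedOn G (_∈ (H ─ H′))) where

  module _ {B : Subset n} {k} (M : Matching (Reach G (_∉ B)) (elements (S ─ B)) k) where
    open Matching M

    end∈S : ∀ i x → end i x ∈ S
    end∈S i x = p─q⊆p S B (∈-elements⁻ (S ─ B) (end∈ i x))

    end∉B : ∀ i x → end i x ∉ B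
    end∉B i x = x∈p─q⇒x∉q S B (∈-elements⁻ (S ─ B) (end∈ i x))

    -- A set of pairs is a function to `Fin 2`, with `suc zero` for membership, so that `funToFin`
    -- encodes it in `Fin (2 ^ k)` for the pigeonhole principle.
    Chosen : (Fin k → Fin 2) → Fin n → Set
    Chosen F v = ∃ λ i → F i ≡ suc zero × (end i true ≡ v ⊎ end i false ≡ v)

    chosen? : ∀ F v → Dec (Chosen F v)
    chosen? F v = any? λ i → (F i ≟ suc zero) ×-dec ((end i true ≟ v) ⊎-dec (end i false ≟ v))

    chosen⁺ : ∀ {F i} → F i ≡ suc zero → ∀ x → Chosen F (end i x)
    chosen⁺ Fi≡1 true  = _ , Fi≡1 , inj₁ refl
    chosen⁺ Fi≡1 false = _ , Fi≡1 , inj₂ refl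

    chosen⁻ : ∀ {F v} → Chosen F v → ∃₂ λ i x → F i ≡ suc zero × end i x ≡ v
    chosen⁻ (i , Fi≡1 , inj₁ eq) = i , true , Fi≡1 , eq
    chosen⁻ (i , Fi≡1 , inj₂ eq) = i , false , Fi≡1 , eq

    member : (Fin k → Fin 2) → Subset n
    member F = proj₁ (shatters (does ∘ chosen? F))

    member-χ : ∀ F → χ (member F) ≡ true
    member-χ F = proj₁ (proj₂ (shatters (does ∘ chosen? F)))

    member-agrees : ∀ F {v} → v ∈ S → Vec.lookup (member F) v ≡ does (chosen? F v)
    member-agrees F = proj₂ (proj₂ (shatters (does ∘ chosen? F))) _

    member⁺ : ∀ F {v} → v ∈ S → Chosen F v → v ∈ member F
    member⁺ F {v} v∈S c = lookup⇒[]= v (member F) (trans (member-agrees F v∈S) (dec-true (chosen? F v) c))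

    member⁻ : ∀ F {v} → v ∈ S → v ∈ member F → Chosen F v
    member⁻ F {v} v∈S v∈H = decidable-stable (chosen? F v) λ ¬c →
      contradiction (trans (sym ([]=⇒lookup v∈H)) (trans (member-agrees F v∈S) (dec-false (chosen? F v) ¬c))) λ ()

    -- The i-th pair lies in member F ─ member F′, which is connected and hence must meet B.
    trace-reflects-⊆ : ∀ F F′ → (∀ {v} → v ∈ B ─ S → v ∈ member F → v ∈ member F′) →
      ∀ {i} → F i ≡ suc zero → F′ i ≡ zero → ⊥
    trace-reflects-⊆ F F′ trace⊆ {i} Fi≡1 F′i≡0 =
      conclude (reach-meets-or-avoids G B (walk⇒reach
        (non-piercing (member F) (member F′) (member-χ F) (member-χ F′) _ _ (pair∈ true) (pair∈ false))))
      where
      pair∉ : ∀ x → end i x ∉ member F′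
      pair∉ x e∈ with chosen⁻ (member⁻ F′ (end∈S i x) e∈)
      ... | j , y , F′j≡1 , eq with disjoint y x eq
      ... | refl = contradiction (trans (sym F′i≡0) F′j≡1) λ ()
      pair∈ : ∀ x → end i x ∈ member F ─ member F′
      pair∈ x = x∈p∧x∉q⇒x∈p─q (member⁺ F (end∈S i x) (chosen⁺ Fi≡1 x)) (pair∉ x)
      conclude : (∃ λ w → w ∈ member F ─ member F′ × w ∈ B) ⊎ Reach G (_∉ B) (end i true) (end i false) → ⊥
      conclude (inj₂ avoiding) = apart i avoiding
      conclude (inj₁ (w , w∈ , w∈B)) with w ∈? S
      -- Outside `S`, the inclusion of traces puts `w` into `member F′`, which has been removed.
      ... | no w∉S = x∈p─q⇒x∉q (member F) (member F′) w∈
              (trace⊆ (x∈p∧x∉q⇒x∈p─q w∈B w∉S) (p─q⊆p (member F) (member F′) w∈))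
      -- Inside `S`, `w` is an end of a chosen pair, and ends avoid `B`.
      ... | yes w∈S with chosen⁻ (member⁻ F w∈S (p─q⊆p (member F) (member F′) w∈))
      ... | j , y , _ , refl = end∉B j y w∈B

    toBit : Bool → Fin 2
    toBit false = zero
    toBit true  = suc zero

    toBit-injective : ∀ b c → toBit b ≡ toBit c → b ≡ c
    toBit-injective false false _ = refl
    toBit-injective true  true  _ = refl

    Q : List (Fin n)
    Q = elements (B ─ S)

    trace : Fin (2 ^ k) → Fin (length Q) → Fin 2
    trace c j = toBit (Vec.lookup (member (finToFun c)) (lookup Q j))

    same-trace : ∀ c c′ → funToFin (trace c) ≡ funToFin (trace c′) → ∀ {v} → v ∈ B ─ S →
      v ∈ member (finToFun c) → v ∈ member (finToFun c′)
    same-trace c c′ eq {v} v∈ v∈H = lookup⇒[]= v _ (trans (sym lookups) ([]=⇒lookup v∈H))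
      where
      v∈Q = ∈-elements⁺ v∈
      bits : ∀ j → trace c j ≡ trace c′ j
      bits j = trans (sym (finToFun-funToFin (trace c) j)) (trans (cong (λ f → finToFun f j) eq) (finToFun-funToFin (trace c′) j))
      lookups : Vec.lookup (member (finToFun c)) v ≡ Vec.lookup (member (finToFun c′)) v
      lookups = subst (λ u → Vec.lookup (member (finToFun c)) u ≡ Vec.lookup (member (finToFun c′)) u)
        (sym (lookup-index v∈Q)) (toBit-injective _ _ (bits (Any.index v∈Q)))

    -- The 2 ^ k members indexed by sets of pairs have distinct traces on B ─ S.
    separated-pairs-bound : k ≤ ∣ B ─ S ∣
    separated-pairs-bound = ≮⇒≥ λ q<k →
      -- With fewer than `k` elements, `B ─ S` admits fewer than `2 ^ k` traces, so two codes share
      -- a trace; being distinct codes, they differ at some pair.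
      let c , c′ , c<c′ , eq = pigeonhole (^-monoʳ-< 2 ≤-refl (subst (_< k) (sym (length-elements (B ─ S))) q<k)) (funToFin ∘ trace)
          i , differ = ¬∀⟶∃¬ k _ (λ i → finToFun {2} {k} c i ≟ finToFun c′ i) λ agree →
            <⇒≢ c<c′ (cong toℕ (trans (sym (funToFin-finToFin {k} {2} c)) (trans (funToFin-cong agree) (funToFin-finToFin {k} {2} c′))))
      in separate c c′ eq i differ
      where
      separate : ∀ c c′ → funToFin (trace c) ≡ funToFin (trace c′) → ∀ i → finToFun {2} {k} c i ≢ finToFun c′ i → ⊥
      separate c c′ eq i differ with finToFun {2} {k} c i in ci | finToFun {2} {k} c′ i in c′i
      ... | zero     | zero     = differ refl
      ... | suc zero | suc zero = differ refl
      ... | suc zero | zero     = trace-reflects-⊆ _ _ (same-trace c c′ eq) ci c′i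
      ... | zero     | suc zero = trace-reflects-⊆ _ _ (same-trace c′ c (sym eq)) c′i ci

  -- Dominant components and pointers in the decomposition tree

  module _ {t} (D : TreeDecomposition G) (width : WidthAtMost D t) (∣S∣ : ∣ S ∣ ≡ suc (3 * t + 3))
    (linked? : ∀ x u v → Dec (Reach G (_∉ bag D x) u v)) where

    private
      Tr = T D
      acyclic = proj₂ (isTree D)

    -- All but suc t elements of S lie in the component of G − bag D x containing centre.
    record Dominant (x : Fin (suc (m D))) : Set where
      field
        centre    : Fin n
        centre∉   : centre ∉ bag D x
        rest      : List (Fin n)
        rest-size : length rest ≤ suc t
        linked    : ∀ {v} → v ∈ S → v ∉ₗ rest → v ∉ bag D x × Reach G (_∉ bag D x) centre v

    -- As `suc q` separated pairs would violate `separated-pairs-bound`, some component misses at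
    -- most `q` elements of `S ─ B`. Together with `B ∩ S` this makes at most `∣ B ∣` exceptions.
    dominant : ∀ x → Dominant x
    dominant x = conclude (matching-or-dominant-class (suc q) L (elements-unique (S ─ B)) enough)
      where
      open ClassMatching (linked? x) ε _◅◅_
      open ≤-Reasoning
      B = bag D x
      L = elements (S ─ B)
      b = ∣ B ∩ S ∣
      q = ∣ B ─ S ∣

      -- Bounding `b` by `2 * b` lets the width enter through `b + q`, which is `∣ B ∣`.
      enough : 2 * suc q ≤ length L
      enough = +-cancelˡ-≤ b (2 * suc q) (length L) (begin
        b + 2 * suc q            ≤⟨ +-monoˡ-≤ (2 * suc q) (m≤m+n b (b + 0)) ⟩
        2 * b + 2 * suc q        ≡⟨ *-distribˡ-+ 2 b (suc q) ⟨
        2 * (b + suc q)          ≡⟨ cong (2 *_) (trans (+-suc b q) (cong suc (∣p∩q∣+∣p─q∣≡∣p∣ B S))) ⟩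
        2 * suc ∣ B ∣            ≤⟨ *-monoʳ-≤ 2 (s≤s (width x)) ⟩
        2 * suc (suc t)          ≡⟨ *-distribˡ-+ 2 2 t ⟩
        4 + 2 * t                ≤⟨ +-monoʳ-≤ 4 (*-monoˡ-≤ t (n≤1+n 2)) ⟩
        4 + 3 * t                ≡⟨ cong suc (+-comm 3 (3 * t)) ⟩
        suc (3 * t + 3)          ≡⟨ ∣S∣ ⟨
        ∣ S ∣                    ≡⟨ ∣p∩q∣+∣p─q∣≡∣p∣ S B ⟨
        ∣ S ∩ B ∣ + ∣ S ─ B ∣    ≡⟨ cong₂ _+_ (cong ∣_∣ (∩-comm S B)) (sym (length-elements (S ─ B))) ⟩
        b + length L             ∎)

      conclude : Matching (Reach G (_∉ B)) L (suc q) ⊎ (∃ λ w → w ∈ₗ L × length (unrelated w L) < suc q) → Dominant x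
      conclude (inj₁ M) = contradiction (separated-pairs-bound M) (<⇒≱ ≤-refl)
      conclude (inj₂ (w , w∈L , U<)) = record
        { centre = w ; centre∉ = x∈p─q⇒x∉q S B (∈-elements⁻ (S ─ B) w∈L)
        ; rest = elements (B ∩ S) ++ U ; rest-size = size ; linked = linked }
        where
        U = unrelated w L

        size : length (elements (B ∩ S) ++ U) ≤ suc t
        size = begin
          length (elements (B ∩ S) ++ U)         ≡⟨ length-++ (elements (B ∩ S)) ⟩
          length (elements (B ∩ S)) + length U   ≤⟨ +-mono-≤ (≤-reflexive (length-elements (B ∩ S))) (≤-pred U<) ⟩
          b + q                                  ≡⟨ ∣p∩q∣+∣p─q∣≡∣p∣ B S ⟩
          ∣ B ∣                                  ≤⟨ width x ⟩
          suc t                                  ∎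

        linked : ∀ {v} → v ∈ S → v ∉ₗ elements (B ∩ S) ++ U → v ∉ B × Reach G (_∉ B) w v
        linked {v} v∈S v∉rest = v∉B , decidable-stable (linked? x w v) λ ¬r →
          v∉rest (∈-++⁺ʳ (elements (B ∩ S))
            (∈-filter⁺ (¬? ∘ linked? x w) (∈-elements⁺ (x∈p∧x∉q⇒x∈p─q v∈S v∉B)) ¬r))
          where
          v∉B : v ∉ B
          v∉B v∈B = v∉rest (∈-++⁺ˡ (∈-elements⁺ (x∈p∩q⁺ (v∈B , v∈S))))

    -- This places `v` on the side of `y` once the node `x` is removed from the tree. One bag
    -- suffices as witness: for `v` outside `bag D x`, `bag-reach` joins all bags containing `v`
    -- without passing `x`.
    Toward : (x y : Fin (suc (m D))) → Fin n → Set
    Toward x y v = ∃ λ z → v ∈ bag D z × Reach Tr (_≢ x) y z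

    module _ {x : Fin (suc (m D))} where
      bag-reach : ∀ {v z z′} → v ∉ bag D x → v ∈ bag D z → v ∈ bag D z′ → Reach Tr (_≢ x) z z′
      bag-reach v∉ v∈z v∈z′ = reach-map Tr (λ { v∈a refl → v∉ v∈a }) (walk⇒reach (coherent D _ _ _ v∈z v∈z′))

      -- Adjacent vertices share a bag, and `bag-reach` leads to it from the known bag of the first;
      -- hence a component of `G` minus the bag of `x` stays on one side.
      toward-linked : ∀ {y u v} → Reach G (_∉ bag D x) u v → Toward x y u → Toward x y v
      toward-linked ε toward = toward
      toward-linked ((uw , u∉ , _) ◅ r) (z , u∈z , y⇝z) =
        let z′ , u∈z′ , w∈z′ = edges D _ _ uw
        in toward-linked r (z′ , w∈z′ , y⇝z ◅◅ bag-reach u∉ u∈z u∈z′)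

      toward-neighbour : ∀ {v} → v ∉ bag D x → ∃ λ y → Adj Tr x y × Toward x y v
      toward-neighbour {v} v∉ =
        let z , v∈z = cover D v
            y , xy , y⇝z = first-step-avoiding Tr (λ { refl → v∉ v∈z })
                             (gmap id proj₁ (walk⇒reach (proj₁ (isTree D) x z _ _)))
        in y , xy , z , v∈z , y⇝z

    -- The walks from `y` to a bag of `v` and on to another bag of `v` avoid `x`, and the walk from
    -- there to `x` avoids `y`. None uses the edge, so together they contradict that it is a bridge.
    toward-asym : ∀ {x y v} → Adj Tr x y → v ∉ bag D x → Toward x y v → Toward y x v → ⊥
    toward-asym {x} {y} xy v∉x (z , v∈z , y⇝z) (z′ , v∈z′ , x⇝z′) =
      edges-are-bridges Tr acyclic xy
        (gmap id avoid-x (y⇝z ◅◅ bag-reach v∉x v∈z v∈z′) ◅◅ gmap id avoid-y (reach-sym Tr x⇝z′))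
      where
      avoid-x : ∀ {a b} → Adj Tr a b × a ≢ x × b ≢ x → Adj (deleteEdge Tr x y) a b
      avoid-x (ab , a≢x , b≢x) = ab , a≢x ∘ proj₁ , b≢x ∘ proj₂
      avoid-y : ∀ {a b} → Adj Tr a b × a ≢ y × b ≢ y → Adj (deleteEdge Tr x y) a b
      avoid-y (ab , a≢y , b≢y) = ab , b≢y ∘ proj₂ , a≢y ∘ proj₁

    -- Of the dominant component only its side of the tree is kept; `next` is then a neighbour
    -- function to which `2-cycle` applies.
    record Pointer (x : Fin (suc (m D))) : Set where
      field
        next        : Fin (suc (m D))
        next-adj    : Adj Tr x next
        rest        : List (Fin n)
        rest-size   : length rest ≤ suc t
        next-toward : ∀ {v} → v ∈ S → v ∉ₗ rest → v ∉ bag D x × Toward x next v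

    pointer : ∀ x → Pointer x
    pointer x = let y , xy , toward = toward-neighbour centre∉ in record
      { next = y ; next-adj = xy ; rest = rest ; rest-size = rest-size
      ; next-toward = λ v∈S v∉ → let v∉x , r = linked v∈S v∉ in v∉x , toward-linked r toward }
      where open Dominant (dominant x)

    -- An element of `S` outside both exception lists would lie on both sides of the edge, against
    -- `toward-asym`. So the lists cover `S`, yet together they have at most 2t + 2 < 3t + 4
    -- entries.
    mutual-pointers-impossible : ∀ {x y} (p : Pointer x) (q : Pointer y) →
      Pointer.next p ≡ y → Pointer.next q ≡ x → ⊥
    mutual-pointers-impossible {x} {y} p q refl y→x =
      <⇒≱ too-few (unique-⊆⇒length-≤ (elements-unique S) covered)
      where
      module p = Pointer p
      module q = Pointer q
      covered : elements S ⊆ p.rest ++ q.rest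
      covered {v} v∈ with Any.any? (v ≟_) p.rest | Any.any? (v ≟_) q.rest
      ... | yes v∈p | _       = ∈-++⁺ˡ v∈p
      ... | no _    | yes v∈q = ∈-++⁺ʳ p.rest v∈q
      ... | no v∉p  | no v∉q  =
        let v∉x , x→v = p.next-toward (∈-elements⁻ S v∈) v∉p
            _   , y→v = q.next-toward (∈-elements⁻ S v∈) v∉q
        in ⊥-elim (toward-asym p.next-adj v∉x x→v (subst (λ z → Toward y z v) y→x y→v))
      open ≤-Reasoning
      too-few : length (p.rest ++ q.rest) < length (elements S)
      too-few = begin-strict
        length (p.rest ++ q.rest)       ≡⟨ length-++ p.rest ⟩
        length p.rest + length q.rest   ≤⟨ +-mono-≤ p.rest-size q.rest-size ⟩
        suc t + suc t                   ≡⟨ cong suc (+-suc t t) ⟩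
        2 + (t + t)                     <⟨ +-mono-≤ {3} {4} {t + t} {3 * t} (n≤1+n 3) (+-monoʳ-≤ t (m≤m+n t (t + 0))) ⟩
        4 + 3 * t                       ≡⟨ cong suc (+-comm 3 (3 * t)) ⟩
        suc (3 * t + 3)                 ≡⟨ ∣S∣ ⟨
        ∣ S ∣                           ≡⟨ length-elements S ⟨
        length (elements S)             ∎

    no-pointers : ¬ (∀ x → Pointer x)
    no-pointers point =
      let x , returns = 2-cycle Tr acyclic (Pointer.next ∘ point) (λ x → Pointer.next-adj (point x)) zero
      in mutual-pointers-impossible (point x) (point (Pointer.next (point x))) refl returns

    no-shattered-set : ⊥
    no-shattered-set = no-pointers pointer

-- From shattering to the polynomial bound

-- Double-negation shift over a finite index set: when the goal is a negation, it makes finitely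
-- many instances of excluded middle available at once.
¬¬-∀ : ∀ {k} {P : Fin k → Set} → (∀ i → ¬ ¬ P i) → ¬ ¬ (∀ i → P i)
¬¬-∀ {zero}  _   ¬all = ¬all λ ()
¬¬-∀ {suc k} ¬¬P ¬all = ¬¬P zero λ P₀ → ¬¬-∀ (¬¬P ∘ suc) λ Pₛ → ¬all (∀-cons P₀ Pₛ)

-- The lower bound on the treewidth yields a bag with at least `suc t` vertices.
treewidth⇒nonempty : (G : Graph n) {t : ℕ} → Treewidth G t → 1 ≤ n
treewidth⇒nonempty G ((D , _) , minimal) = let x , t< = minimal D in ≤-trans (s≤s z≤n) (≤-trans t< (∣p∣≤n (bag D x)))

_∈ₛ?_ : (H : Subset n) (ℋ : List (Subset n)) → Dec (H ∈ₗ ℋ)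
H ∈ₛ? ℋ = Any.any? (≡-dec _≟ᵇ_ H) ℋ

familyOf : List (Subset n) → Family n
familyOf ℋ H = does (H ∈ₛ? ℋ)

familyOf⁻ : (ℋ : List (Subset n)) (H : Subset n) → familyOf ℋ H ≡ true → H ∈ₗ ℋ
familyOf⁻ ℋ H χH = decidable-stable (H ∈ₛ? ℋ) λ H∉ → contradiction (trans (sym χH) (dec-false (H ∈ₛ? ℋ) H∉)) λ ()

^-distribʳ-* : ∀ k m n → (m * n) ^ k ≡ m ^ k * n ^ k
^-distribʳ-* zero    m n = refl
^-distribʳ-* (suc k) m n = trans (cong (m * n *_) (^-distribʳ-* k m n))
  (interchange *-commutativeSemigroup m n (m ^ k) (n ^ k))

length-bound : (G : Graph n) {t : ℕ} → Treewidth G t → (ℋ : List (Subset n)) → NonPiercingFamily G ℋ →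
  length ℋ ≤ 2 ^ (3 * t + 3) * n ^ (3 * t + 3)
length-bound {n} G {t} tw@((D , width) , _) ℋ (unique , _ , np) = begin
  length ℋ                     ≤⟨ unique-⊆⇒length-≤ unique (λ {H} H∈ → ∈-members χ H (dec-true (H ∈ₛ? ℋ) H∈)) ⟩
  length (members χ)           ≡⟨ length-members χ ⟩
  count χ                      ≤⟨ ≮⇒≥ small ⟩
  -- Since `1 ≤ n`, `suc n` is at most `2 * n`; this is the source of the constant
  -- `2 ^ (3 * t + 3)`.
  suc n ^ (3 * t + 3)          ≤⟨ ^-monoˡ-≤ (3 * t + 3) (+-mono-≤ (treewidth⇒nonempty G tw) (m≤m+n n 0)) ⟩
  (2 * n) ^ (3 * t + 3)        ≡⟨ ^-distribʳ-* (3 * t + 3) 2 n ⟩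
  2 ^ (3 * t + 3) * n ^ (3 * t + 3) ∎
  where
  open ≤-Reasoning
  χ = familyOf ℋ
  small : ¬ sauerBound (suc (3 * t + 3)) n < count χ
  -- Adjacency is not assumed decidable; as the goal is a negation, linkedness may be decided classically.
  small big =
    let S , ∣S∣ , shatters = sauer-shelah (suc (3 * t + 3)) χ big
        open Shattering G χ S shatters (λ H H′ χH χH′ → np H H′ (familyOf⁻ ℋ H χH) (familyOf⁻ ℋ H′ χH′))
    in ¬¬-∀ (λ x → ¬¬-∀ λ u → ¬¬-∀ λ v → ¬¬-excluded-middle) (no-shattered-set D width ∣S∣)

theorem7 : (t : ℕ) → Σ ℕ λ C →
    ∀ (n : ℕ) (G : Graph n) → Treewidth G t →
    ∀ (ℋ 𝒦 : List (Subset n)) → NonPiercingFamily G ℋ → NonPiercingFamily G 𝒦 →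
    (length ℋ ≤ C * n ^ (3 * t + 3)) × (length 𝒦 ≤ C * n ^ (3 * t + 3))
theorem7 t = 2 ^ (3 * t + 3) , λ n G tw ℋ 𝒦 npℋ np𝒦 → length-bound G tw ℋ npℋ , length-bound G tw 𝒦 np𝒦
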